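{- For every abstract mathematician $\mu$: if $\Phi_\mu=\mathfrak t$ (i.e. $\mu$ is faultless) and $A_\mu=\mathfrak t$ (i.e. $\mu(T_{\mathfrak M}\,\theta\,P_{\mathfrak M})=1$ for every $\mathfrak M\in\mathbb M$), then $\mu\neq\widetilde{\mathfrak S}$ for every special Turing machine $\mathfrak S$.
   Context: **Words and machines.** $\mathbb A$ is a finite alphabet, $\theta\notin\mathbb A$ is a symbol, $\mathbb B=\mathbb A\cup\{\theta\}$; $\mathbb A^*,\mathbb B^*$ are the sets of all words. For $\mathbb V,\mathbb U\subseteq\mathbb B^*$, $\mathbb V\theta\mathbb U=\{v\theta u: v\in\mathbb V,u\in\mathbb U\}$. Turing machines (TMs) have tape alphabet $\mathbb B$; $\mathbb M$ is the set of all TMs, each identified with a word (its code), so $\mathbb M\subset\mathbb A^*$ ($\mathbb M$ is enumerable). For a TM $\mathfrak M$ and $b\in\mathbb B^*$, $[\mathfrak M,b]\neq\infty$ means that $\mathfrak M$ started on initial tape contents $b$ eventually halts; otherwise $[\mathfrak M,b]=\infty$. A special Turing machine (STM) is like a TM except that it has two final states, one marked "Proved", the other "Not Proved". **Abstract mathematicians.** $\mathbb H=\mathbb C=\mathbb A^*$ (hypotheses, conclusions), $\mathbb P=\mathbb B^*$ (proofs), $\mathbb T=\mathbb H\theta\mathbb C$ (abstract theorems). An element $t\in\mathbb T$ is written uniquely as $t=H_t\theta C_t$. An abstract mathematician (AM) is any map $\mu:\mathbb T\theta\mathbb P\to\{0,1\}$. Write $p\xrightarrow{\mu}t$ if $\mu(t\theta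 p)=1$, and $\mu\vdash t$ if $p\xrightarrow{\mu}t$ for some $p\in\mathbb P$. For a TM $\mathfrak M$, the AM $\widehat{\mathfrak M}$ is defined by $\widehat{\mathfrak M}(t\theta p)=1\Leftrightarrow[\mathfrak M,t\theta p]\neq\infty$. For an STM $\mathfrak S$, the AM $\widetilde{\mathfrak S}$ is defined by: $\widetilde{\mathfrak S}(t\theta p)=1$ iff $\mathfrak S$ started on $t\theta p$ reaches the final state marked "Proved". **Truth status.** Every $a\in\mathbb A^*$ has exactly one of three statuses: $a=\mathfrak t$ ($a$ is a true statement), $a=\mathfrak f$ ($a$ is a false statement), $a=\mathfrak u$ (neither: $a$ is not a statement, or is a statement that can be neither true nor false). Thus if $a=\mathfrak t$ then what $a$ asserts holds, and if $a=\mathfrak f$ then what it asserts fails. **The statements $\sigma_{\mathfrak K}$ and $\Phi_\mu$.** For a TM $\mathfrak K$, $\sigma_{\mathfrak K}\in\mathbb A^*$ is the word expressing "$[\mathfrak K,\mathfrak K]=\infty$", computable from $\mathfrak K$. One has $\sigma_{\mathfrak K}\ne\mathfrak u$ always, so $\sigma_{\mathfrak K}=\mathfrak t\Leftrightarrow[\mathfrak K,\mathfrak K]=\infty$ and $\sigma_{\mathfrak K}=\mathfrak f\Leftrightarrow[\mathfrak K,\mathfrak K]\neq\infty$. For an AM $\mu$, $\Phi_\mu$ is the statement $$\forall_{p\in\mathbb P}\forall_{t\in\mathbb T}\Big(\big(p\xrightarrow{\mu}t\big)\Rightarrow\big((H_t=\mathfrak t)\Rightarrow(C_t=\mathfrak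 t)\big)\Big),$$ which may have any of the statuses $\mathfrak t,\mathfrak f,\mathfrak u$ (it may refer to its own status). If $\Phi_\mu=\mathfrak t$ the displayed condition holds, and if $\Phi_\mu=\mathfrak f$ it fails. The status of $\Phi_\mu$ depends only on the map $\mu$. For a TM $\mathfrak M$, $\Phi_{\widehat{\mathfrak M}}$ is also a word in $\mathbb A^*$, computable from $\mathfrak M$, whose status as a word is the status of the statement. $\mu$ is called faultless if $\Phi_\mu=\mathfrak t$. **The machine $\mathfrak L^{(\mathfrak M)}$.** For a TM $\mathfrak M$ and $h\in\mathbb H$, $\mathfrak T_{\mathfrak M,h}$ is a TM (constructed by a fixed algorithm from $\mathfrak M,h$) that, on input $c\in\mathbb C$, searches by dovetailing over all $p\in\mathbb P$ for one with $[\mathfrak M,h\theta c\theta p]\ne\infty$ and halts iff one is found; it does not halt on inputs outside $\mathbb C$. For a TM $\mathfrak T$, $\mathfrak L_{\mathfrak T}$ is a TM (constructed by a fixed algorithm from $\mathfrak T$) that on input $\mathfrak D\in\mathbb M$ simulates $[\mathfrak T,\sigma_{\mathfrak D}]$ (halting iff it halts) and does not halt on inputs outside $\mathbb M$. Put $\mathfrak L^{(\mathfrak M)}=\mathfrak L_{\mathfrak T}$ with $\mathfrak T=\mathfrak T_{\mathfrak M,h}$ and $h=\Phi_{\widehat{\mathfrak M}}$. **The statement $A_\mu$.** For a TM $\mathfrak M$ put $C_{\mathfrak M}=\sigma_{\mathfrak L^{(\mathfrak M)}}$ and $T_{\mathfrak M}=\Phi_{\widehat{\mathfrak M}}\,\theta\,C_{\mathfrak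 M}\in\mathbb T$. Let $P_{\mathfrak M}\in\mathbb P$ be the fixed word, depending on $\mathfrak M$, which is the text of the written proof that $(\Phi_{\widehat{\mathfrak M}}=\mathfrak t)\Rightarrow(\sigma_{\mathfrak L^{(\mathfrak M)}}=\mathfrak t)$; $\mathfrak M\mapsto P_{\mathfrak M}$ may be regarded as a fixed map $\mathbb M\to\mathbb P$. For an AM $\mu$, $A_\mu$ is the statement $\forall_{\mathfrak M\in\mathbb M}\big(P_{\mathfrak M}\xrightarrow{\mu}T_{\mathfrak M}\big)$. -}

module Defs where

open import Data.Bool using (Bool; true)
open import Data.Fin using (Fin)
open import Data.List using (List; []; _∷_; _++_; map)
open import Data.Maybe using (Maybe; just; nothing)
open import Data.Nat using (ℕ; zero; suc)
open import Data.Product using (_×_; _,_; ∃; ∃-syntax)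
open import Data.Sum using (_⊎_; inj₁; inj₂)
open import Data.Unit using (⊤; tt)
open import Data.Vec using (Vec; lookup)
open import Function.Bundles using (_⇔_)
open import Function.Definitions using (Injective)
open import Relation.Binary.PropositionalEquality using (_≡_; _≢_)
open import Relation.Nullary using (¬_)

data Status : Set where
  𝔱 𝔣 𝔲 : Status

data Direction : Set where
  left stay right : Direction

data Verdict : Set where
  proved notProved : Verdict

module Framework (k : ℕ) where

  𝔸 : Set
  𝔸 = Fin k

  𝔹 : Set
  𝔹 = Maybe 𝔸

  θ : 𝔹
  θ = nothing

  𝔸* 𝔹* : Set
  𝔸* = List 𝔸
  𝔹* = List 𝔹

  ι : 𝔸* → 𝔹*
  ι = map just

  -- A tape cell carries a symbol of 𝔹 or is empty.  Emptiness is not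
  -- represented by θ: otherwise b and b θ would be the same initial tape, and
  -- no machine could halt on c ∈ 𝔸* without also halting on c θ.
  Cell : Set
  Cell = Maybe 𝔹

  -- The transition table is first-order data rather than a function on Cell,
  -- so that propositional equality of machines is equality of tables (as is
  -- needed to identify machines with their codes) without function
  -- extensionality.
  record Row (X : Set) : Set where
    constructor row
    field
      on-empty  : X
      on-θ      : X
      on-letter : Vec X k

  entry : ∀ {X} → Row X → Cell → X
  entry r nothing         = Row.on-empty r
  entry r (just nothing)  = Row.on-θ r
  entry r (just (just a)) = lookup (Row.on-letter r) a

  -- Deterministic machines with one two-way infinite tape and set F of final
  -- states.  The remaining states are Fin size.
  record Machine (F : Set) : Set where
    constructor machine
    field
      size  : ℕ
      start : Fin size ⊎ F
      table : Vec (Row ((Fin size ⊎ F) × Cell × Direction)) size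

  TM : Set
  TM = Machine ⊤

  STM : Set
  STM = Machine Verdict

  -- tape ls c rs: the head scans c; ls lists the cells to its left, nearest
  -- first, and rs those to its right.  All unlisted cells are empty.
  record Tape : Set where
    constructor tape
    field
      before : List Cell
      head   : Cell
      after  : List Cell

  initialTape : 𝔹* → Tape
  initialTape []      = tape [] nothing []
  initialTape (x ∷ w) = tape [] (just x) (map just w)

  write : Cell → Tape → Tape
  write c (tape ls _ rs) = tape ls c rs

  move : Direction → Tape → Tape
  move left  (tape [] c rs)       = tape [] nothing (c ∷ rs)
  move left  (tape (l ∷ ls) c rs) = tape ls l (c ∷ rs)
  move stay  t                    = t
  move right (tape ls c [])       = tape (c ∷ ls) nothing []
  move right (tape ls c (r ∷ rs)) = tape (c ∷ ls) r rs

  -- The output is read from the scanned cell rightwards up to the first empty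
  -- cell.
  readWord : List Cell → 𝔹*
  readWord []             = []
  readWord (nothing ∷ _)  = []
  readWord (just x  ∷ cs) = x ∷ readWord cs

  output : Tape → 𝔹*
  output (tape _ c rs) = readWord (c ∷ rs)

  module _ {F : Set} (N : Machine F) where
    open Machine N

    Config : Set
    Config = (Fin size ⊎ F) × Tape

    initial : 𝔹* → Config
    initial b = start , initialTape b

    step : Config → Config
    step (inj₂ f , t) = inj₂ f , t
    step (inj₁ q , t) with entry (lookup table q) (Tape.head t)
    ... | q′ , c , d = q′ , move d (write c t)

    run : ℕ → Config → Config
    run zero    x = x
    run (suc n) x = run n (step x)

    Reaches : F → 𝔹* → Set
    Reaches f b = ∃[ n ] ∃[ t ] run n (initial b) ≡ (inj₂ f , t)

  [_,_]≠∞ : TM → 𝔹* → Set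
  [ 𝔐 , b ]≠∞ = Reaches 𝔐 tt b

  [_,_]=∞ : TM → 𝔹* → Set
  [ 𝔐 , b ]=∞ = ¬ [ 𝔐 , b ]≠∞

  _On_Yields_ : TM → 𝔹* → 𝔹* → Set
  N On b Yields w =
    ∃[ n ] ∃[ t ] run N n (initial N b) ≡ (inj₂ tt , t) × output t ≡ w

  Computable : {X : Set} → (X → 𝔹*) → (X → 𝔹*) → Set
  Computable input f = ∃[ N ] ∀ x → N On input x Yields f x

  ℍ ℂ ℙ : Set
  ℍ = 𝔸*
  ℂ = 𝔸*
  ℙ = 𝔹*

  -- Words of ℍ θ ℂ and of 𝕋 θ ℙ are represented by their components; since
  -- θ ∉ 𝔸, a word t θ p determines H t, C t and p.
  record 𝕋 : Set where
    constructor _⟨θ⟩_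
    field
      H : ℍ
      C : ℂ
  open 𝕋 public

  record 𝕋θℙ : Set where
    constructor _⊢θ_
    field
      theorem : 𝕋
      proof   : ℙ

  word : 𝕋θℙ → 𝔹*
  word (t ⊢θ p) = (ι (H t) ++ θ ∷ ι (C t)) ++ θ ∷ p

  -- Value 1 is true.
  AM : Set
  AM = 𝕋θℙ → Bool

  _⟶[_]_ : ℙ → AM → 𝕋 → Set
  p ⟶[ μ ] t = μ (t ⊢θ p) ≡ true

  -- The AMs attached to a TM or an STM are in general not computable, so not definable
  -- as closed functions into Bool.  Each is given by its defining property
  -- instead, which determines it pointwise: "μ ≐hat 𝔐" and "μ ≐tilde 𝔖" say
  -- that μ is the AM attached to 𝔐, respectively to 𝔖.
  _≐hat_ : AM → TM → Set
  μ ≐hat 𝔐 = ∀ x → (μ x ≡ true) ⇔ [ 𝔐 , word x ]≠∞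

  _≐tilde_ : AM → STM → Set
  μ ≐tilde 𝔖 = ∀ x → (μ x ≡ true) ⇔ Reaches 𝔖 proved (word x)

  -- The data that are fixed but not specified further: the coding of machines,
  -- the truth statuses, the words σ and Φ̂, the machines 𝔗 and 𝔏, the texts P.
  record Setting : Set where
    field
      code            : TM → 𝔸*
      code-injective  : Injective _≡_ _≡_ code

    ⌜_⌝ : TM → 𝔹*
    ⌜ 𝔐 ⌝ = ι (code 𝔐)

    ∈𝕄 : 𝔹* → Set
    ∈𝕄 b = ∃[ 𝔐 ] b ≡ ⌜ 𝔐 ⌝

    ∈ℂ : 𝔹* → Set
    ∈ℂ b = ∃[ c ] b ≡ ι c

    field
      𝕄-enumerable : ∃[ 𝔈 ] ∀ b → [ 𝔈 , b ]≠∞ ⇔ ∈𝕄 b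

      status : 𝔸* → Status

      σ            : TM → 𝔸*
      σ-computable : Computable ⌜_⌝ (λ 𝔎 → ι (σ 𝔎))
      σ≢𝔲          : ∀ 𝔎 → status (σ 𝔎) ≢ 𝔲
      σ-𝔱          : ∀ 𝔎 → status (σ 𝔎) ≡ 𝔱 ⇔ [ 𝔎 , ⌜ 𝔎 ⌝ ]=∞
      σ-𝔣          : ∀ 𝔎 → status (σ 𝔎) ≡ 𝔣 ⇔ [ 𝔎 , ⌜ 𝔎 ⌝ ]≠∞

    Φ-Condition : AM → Set
    Φ-Condition μ =
      ∀ p t → p ⟶[ μ ] t → status (H t) ≡ 𝔱 → status (C t) ≡ 𝔱

    -- Φ μ is the status of the statement Φ_μ.  It is not determined by
    -- Φ-Condition μ, since it may also be 𝔲.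
    field
      Φ     : AM → Status
      Φ-𝔱   : ∀ μ → Φ μ ≡ 𝔱 → Φ-Condition μ
      Φ-𝔣   : ∀ μ → Φ μ ≡ 𝔣 → ¬ Φ-Condition μ
      Φ-ext : ∀ μ ν → (∀ x → μ x ≡ ν x) → Φ μ ≡ Φ ν

      Φ̂            : TM → 𝔸*
      Φ̂-computable : Computable ⌜_⌝ (λ 𝔐 → ι (Φ̂ 𝔐))
      Φ̂-status     : ∀ 𝔐 μ → μ ≐hat 𝔐 → status (Φ̂ 𝔐) ≡ Φ μ

      𝔗            : TM → ℍ → TM
      𝔗-computable : Computable {TM × ℍ} (λ (𝔐 , h) → ⌜ 𝔐 ⌝ ++ θ ∷ ι h)
                                         (λ (𝔐 , h) → ⌜ 𝔗 𝔐 h ⌝)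
      𝔗-inside     : ∀ 𝔐 h c → [ 𝔗 𝔐 h , ι c ]≠∞ ⇔
                                (∃[ p ] [ 𝔐 , word ((h ⟨θ⟩ c) ⊢θ p) ]≠∞)
      𝔗-outside    : ∀ 𝔐 h b → ¬ ∈ℂ b → [ 𝔗 𝔐 h , b ]=∞

      𝔏            : TM → TM
      𝔏-computable : Computable ⌜_⌝ (λ 𝔎 → ⌜ 𝔏 𝔎 ⌝)
      𝔏-inside     : ∀ 𝔎 𝔇 → [ 𝔏 𝔎 , ⌜ 𝔇 ⌝ ]≠∞ ⇔ [ 𝔎 , ι (σ 𝔇) ]≠∞
      𝔏-outside    : ∀ 𝔎 b → ¬ ∈𝕄 b → [ 𝔏 𝔎 , b ]=∞

    𝔏⁽_⁾ : TM → TM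
    𝔏⁽ 𝔐 ⁾ = 𝔏 (𝔗 𝔐 (Φ̂ 𝔐))

    T : TM → 𝕋
    T 𝔐 = Φ̂ 𝔐 ⟨θ⟩ σ 𝔏⁽ 𝔐 ⁾

    field
      P : TM → ℙ

    A-Condition : AM → Set
    A-Condition μ = ∀ 𝔐 → P 𝔐 ⟶[ μ ] T 𝔐

    -- A μ is the status of the statement A_μ.
    field
      A   : AM → Status
      A-𝔱 : ∀ μ → A μ ≡ 𝔱 ⇔ A-Condition μ
      A-𝔣 : ∀ μ → A μ ≡ 𝔣 → ¬ A-Condition μ

{-# OPTIONS --safe #-}
-- Turn 𝔖 into a TM 𝔐 that loops where 𝔖 answers "Not Proved"; then μ is also
-- the AM attached to 𝔐, so that Φ̂ 𝔐 has status 𝔱.  Since P 𝔐 is accepted by μ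
-- as a proof of T 𝔐 and μ is faultless, σ 𝔏⁽ 𝔐 ⁾ is true, that is, 𝔏⁽ 𝔐 ⁾ does
-- not halt on its own code.  But 𝔏⁽ 𝔐 ⁾ on its own code searches for a proof of
-- T 𝔐 accepted by 𝔐, and P 𝔐 is one, so it halts.
module Submission where

open import Defs
open import Data.Fin using (Fin; zero; suc)
open import Data.Maybe using (just; nothing)
open import Data.Nat using (ℕ; zero; suc)
open import Data.Product using (_×_; _,_; map₁)
open import Data.Sum using (_⊎_; inj₁; inj₂)
open import Data.Unit using (⊤; tt)
open import Data.Vec using (_∷_; lookup; map; tabulate)
open import Data.Vec.Properties using (lookup-map; lookup∘tabulate)
open import Function.Base using (_∘_)
open import Function.Bundles using (_⇔_; mk⇔; module Equivalence)
open import Function.Construct.Composition using (_⇔-∘_)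
open import Relation.Binary.PropositionalEquality
  using (_≡_; refl; sym; trans; cong)
open import Relation.Nullary using (¬_)

module LoopUnlessProved (k : ℕ) where
  open Framework k

  mapRow : ∀ {X Y} → (X → Y) → Row X → Row Y
  mapRow f (row e o l) = row (f e) (f o) (map f l)

  tabulateRow : ∀ {X} → (Cell → X) → Row X
  tabulateRow f = row (f nothing) (f (just nothing)) (tabulate (f ∘ just ∘ just))

  entry-mapRow : ∀ {X Y} (f : X → Y) r c → entry (mapRow f r) c ≡ f (entry r c)
  entry-mapRow f r nothing         = refl
  entry-mapRow f r (just nothing)  = refl
  entry-mapRow f r (just (just a)) = lookup-map a f (Row.on-letter r)

  entry-tabulateRow : ∀ {X} (f : Cell → X) c → entry (tabulateRow f) c ≡ f c
  entry-tabulateRow f nothing         = refl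
  entry-tabulateRow f (just nothing)  = refl
  entry-tabulateRow f (just (just a)) = lookup∘tabulate (f ∘ just ∘ just) a

  -- State `zero` is the added looping state; the old states are shifted up to make room for it.
  embed : ∀ {n} → Fin n ⊎ Verdict → Fin (suc n) ⊎ ⊤
  embed (inj₁ q)         = inj₁ (suc q)
  embed (inj₂ proved)    = inj₂ tt
  embed (inj₂ notProved) = inj₁ zero

  -- The looping state leaves the tape unchanged, so that simulation commutes
  -- strictly with step, also after the verdict "Not Proved".
  loopUnlessProved : STM → TM
  loopUnlessProved (machine n s δ) =
    machine (suc n) (embed s)
      (tabulateRow (λ c → inj₁ zero , c , stay) ∷ map (mapRow (map₁ embed)) δ)

  module _ (𝔖 : STM) where
    private 𝔐 = loopUnlessProved 𝔖

    step-embed : ∀ x → step 𝔐 (map₁ embed x) ≡ map₁ embed (step 𝔖 x)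
    step-embed (inj₁ q , t)
      rewrite lookup-map q (mapRow (map₁ embed)) (Machine.table 𝔖)
            | entry-mapRow (map₁ embed) (lookup (Machine.table 𝔖) q) (Tape.head t)
      = refl
    step-embed (inj₂ proved , t) = refl
    step-embed (inj₂ notProved , t)
      rewrite entry-tabulateRow {(Fin (suc (Machine.size 𝔖)) ⊎ ⊤) × Cell × Direction}
                (λ c → inj₁ zero , c , stay) (Tape.head t)
      = refl

    run-embed : ∀ n x → run 𝔐 n (map₁ embed x) ≡ map₁ embed (run 𝔖 n x)
    run-embed zero    x = refl
    run-embed (suc n) x =
      trans (cong (run 𝔐 n) (step-embed x)) (run-embed n (step 𝔖 x))

    -- `proved` is the only state that `embed` sends to a final one, so a halt of `𝔐` can be traced
    -- back to `𝔖`.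
    embed-final : ∀ (x : Config 𝔖) {t} → map₁ embed x ≡ (inj₂ tt , t) → x ≡ (inj₂ proved , t)
    embed-final (inj₂ proved , t) refl = refl

    proved⇔halts : ∀ b → Reaches 𝔖 proved b ⇔ [ 𝔐 , b ]≠∞
    proved⇔halts b = mk⇔
      (λ (n , t , eq) →
        n , t , trans (run-embed n (initial 𝔖 b)) (cong (map₁ embed) eq))
      (λ (n , t , eq) →
        n , t , embed-final _ (trans (sym (run-embed n (initial 𝔖 b))) eq))

open Equivalence using (to; from)

-- The diagonal argument is run for TMs, since `Φ̂`, `𝔗` and `P` take a TM.
faultless∧A⇒≢hat : (k : ℕ) → let open Framework k in
    (𝒮 : Setting) → let open Setting 𝒮 in
    (μ : AM) → Φ μ ≡ 𝔱 → A μ ≡ 𝔱 → ∀ (𝔐 : TM) → ¬ (μ ≐hat 𝔐)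
faultless∧A⇒≢hat k 𝒮 μ Φμ Aμ 𝔐 μ≐𝔐 = to (σ-𝔱 𝔏⁽ 𝔐 ⁾) σ-true 𝔏-halts
  where
  open Framework k
  open Setting 𝒮

  accepted : P 𝔐 ⟶[ μ ] T 𝔐
  accepted = to (A-𝔱 μ) Aμ 𝔐

  σ-true : status (σ 𝔏⁽ 𝔐 ⁾) ≡ 𝔱
  -- The hypothesis of `T 𝔐` is the faultlessness of `μ` itself, so `Φμ` serves twice: for soundness
  -- and for the truth of that hypothesis.
  σ-true = Φ-𝔱 μ Φμ (P 𝔐) (T 𝔐) accepted (trans (Φ̂-status 𝔐 μ μ≐𝔐) Φμ)

  𝔏-halts : [ 𝔏⁽ 𝔐 ⁾ , ⌜ 𝔏⁽ 𝔐 ⁾ ⌝ ]≠∞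
  -- Self-application: the input machine is `𝔏⁽ 𝔐 ⁾`, so the conclusion searched for is `σ 𝔏⁽ 𝔐 ⁾`,
  -- that of `T 𝔐`.
  𝔏-halts = from (𝔏-inside _ _) (from (𝔗-inside _ _ _)
    (P 𝔐 , to (μ≐𝔐 _) accepted))

mainTheorem1 : (k : ℕ) → let open Framework k in
    (𝒮 : Setting) → let open Setting 𝒮 in
    (μ : AM) → Φ μ ≡ 𝔱 → A μ ≡ 𝔱 → ∀ (𝔖 : STM) → ¬ (μ ≐tilde 𝔖)
mainTheorem1 k 𝒮 μ Φμ Aμ 𝔖 μ≐𝔖 =
  faultless∧A⇒≢hat k 𝒮 μ Φμ Aμ (loopUnlessProved 𝔖)
    (λ x → proved⇔halts 𝔖 (Framework.word k x) ⇔-∘ μ≐𝔖 x)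
  where open LoopUnlessProved k
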